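{- For $t=\infty$, the Lowest-Cost-Path algorithm (LCP), with any deterministic tie-breaking rule fixed in advance, attains a competitive ratio of $2/3$ in $\mathrm{OMP}_3(1,\infty)$: for every instance $(G,\pi)$, the final matching $M$ produced by LCP satisfies $|M|\ge \frac23\,\nu(G)$.
   Context: Online bipartite matching: an instance $(G,\pi)$ is a finite bipartite graph $G=(L,R,E)$ and an arrival order $\pi$ of $R$. The offline side $L$ is known in advance; online vertices $j\in R$ arrive one by one in order $\pi$, and upon arrival of $j$ all edges incident to $j$ are revealed. The algorithm maintains a matching $M$, initially empty. A vertex is free if it is currently unmatched. $\nu(G)$ is the maximum size of a matching in $G$. $\mathrm{OMP}_3(s,t)$ for $s,t\in\mathbb N\cup\{\infty\}$: upon arrival of $j$, the algorithm either leaves $j$ unmatched (forever, unless matched at this moment) or augments the current matching along an augmenting path of length $1$ or $3$ that starts at $j$ and ends at a free vertex of $L$. A length-1 path $[j~i]$ adds $ji$ with $i\in L$ free. A length-3 path $[j~x~y~i]$, with $x,i\in L$, $y\in R$, $xy\in M$, $i$ free, $jx,yi\in E$, replaces $M$ by $(M\setminus\{xy\})\cup\{jx,yi\}$; then $x$ and $y$ are each said to be reassigned once (they are matched before and after, to different neighbors). Over the execution, each vertex of $L$ may be reassigned at most $s$ times and each vertex of $R$ at most $t$ times. A vertex is exhausted once it has reached its budget; an augmentation is feasible if every vertex it would reassign is not exhausted before it. LCP: upon arrival of $j$, assign to each feasible augmenting path starting at $j$ a cost: a length-1 path has cost $-1$; a length-3 path $[j~x~y~i]$ has cost equal to the number of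 times $y$ has been reassigned before this move. If some feasible path of length 1 or 3 exists, augment along one of minimum cost (ties broken by an arbitrary fixed deterministic rule); otherwise leave $j$ unmatched. -}

module Defs where

open import Data.Bool using (Bool; T)
open import Data.Bool.Properties using (T?)
open import Data.Fin using (Fin; zero; suc)
import Data.Fin.Properties as Fin
open import Data.Fin.Permutation using (Permutation′; _⟨$⟩ʳ_)
open import Data.Fin.Subset using (Subset)
open import Data.Integer as ℤ using (ℤ; +_; -1ℤ)
open import Data.List using
  (List; []; _∷_; _++_; map; filter; length; allFin; tabulate; lookup; cartesianProduct; cartesianProductWith)
open import Data.List.Extrema.Nat using (max; xs≤max; argmax-sel)
open import Data.List.Membership.Propositional using (_∈_; _∉_)
open import Data.List.Membership.Propositional.Properties using
  (∈-map⁺; ∈-map⁻; ∈-filter⁺; ∈-filter⁻; ∈-cartesianProduct⁺; ∈-cartesianProductWith⁺; ∈-allFin; ∈-lookup)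
import Data.List.Membership.DecPropositional as DecMembership
open import Data.List.NonEmpty using (List⁺; _∷_; toList)
open import Data.List.Properties using (length-map)
open import Data.List.Relation.Unary.All as All using (All; []; _∷_; all?)
open import Data.List.Relation.Unary.AllPairs as AllPairs using (AllPairs; []; _∷_; allPairs?)
import Data.List.Relation.Unary.AllPairs.Properties as AllPairs
open import Data.List.Relation.Unary.Any using (here; there)
open import Data.List.Relation.Unary.Unique.Propositional using (Unique)
open import Data.Nat using (ℕ; zero; suc; _≤_; _<_; s≤s; _<?_)
open import Data.Product using (∃-syntax; _×_; _,_; proj₁; proj₂; uncurry)
open import Data.Product.Properties using (≡-dec)
open import Data.Sum using (inj₁; inj₂)
open import Data.Unit using (⊤; tt)
import Data.Vec as Vec
open import Data.Vec.Functional using (Vector; updateAt)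
open import Relation.Binary using (DecidableEquality)
open import Relation.Binary.Construct.Add.Supremum.Strict _<_ using (_<⁺_; <⁺-dec)
open import Relation.Binary.PropositionalEquality using (_≡_; _≢_; refl; sym; cong; subst)
open import Relation.Nullary using (Dec; yes; no; ¬?; _×-dec_; contradiction)
open import Relation.Nullary.Construct.Add.Supremum using (_⁺; [_])
open import Relation.Unary using (Pred; Decidable)

record BipartiteGraph (l r : ℕ) : Set where
  field
    adjacent : Fin l → Fin r → Bool

  E : Fin l → Fin r → Set
  E i j = T (adjacent i j)

  E? : ∀ i j → Dec (E i j)
  E? i j = T? (adjacent i j)

  neighbours : Fin r → Subset l
  neighbours j = Vec.tabulate (λ i → adjacent i j)

open BipartiteGraph

Edge : ℕ → ℕ → Set
Edge l r = Fin l × Fin r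

_≟ᵉ_ : ∀ {l r} → DecidableEquality (Edge l r)
_≟ᵉ_ = ≡-dec Fin._≟_ Fin._≟_

VertexDisjoint : ∀ {l r} → Edge l r → Edge l r → Set
VertexDisjoint (i , j) (i′ , j′) = i ≢ i′ × j ≢ j′

-- VertexDisjoint is irreflexive, so a matching lists each of its edges once
-- and its cardinality is the length of the list.
IsMatching : ∀ {l r} → BipartiteGraph l r → Pred (List (Edge l r)) _
IsMatching G M = All (uncurry (E G)) M × AllPairs VertexDisjoint M

isMatching? : ∀ {l r} (G : BipartiteGraph l r) → Decidable (IsMatching G)
isMatching? G M =
  all? (uncurry (E? G)) M
  ×-dec
  allPairs? (λ (i , j) (i′ , j′) → ¬? (i Fin.≟ i′) ×-dec ¬? (j Fin.≟ j′)) M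

listsUpTo : ∀ {a} {A : Set a} → ℕ → List A → List (List A)
listsUpTo zero    xs = [] ∷ []
listsUpTo (suc n) xs = [] ∷ cartesianProductWith _∷_ xs (listsUpTo n xs)

-- A matching has at most one edge at each of the l offline vertices, so
-- searching the lists of length at most l misses none; see ν-maximum.
matchings : ∀ {l r} → BipartiteGraph l r → List (List (Edge l r))
matchings {l} {r} G =
  filter (isMatching? G) (listsUpTo l (cartesianProduct (allFin l) (allFin r)))

ν : ∀ {l r} → BipartiteGraph l r → ℕ
ν G = max 0 (map length (matchings G))

-- Budgets range over ℕ ∪ {∞}, with ⊤⁺ as ∞.
Budget : Set
Budget = ℕ ⁺

-- The edges of an augmenting path, apart from its starting vertex j:
-- direct i is [ j i ] and swap x y i is [ j x y i ].
data Path (l r : ℕ) : Set where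
  direct : (i : Fin l) → Path l r
  swap   : (x : Fin l) (y : Fin r) (i : Fin l) → Path l r

paths : ∀ l r → List (Path l r)
paths l r =
  map direct (allFin l)
  ++ map (λ (x , y , i) → swap x y i)
         (cartesianProduct (allFin l) (cartesianProduct (allFin r) (allFin l)))

record State (l r : ℕ) : Set where
  constructor state
  field
    M             : List (Edge l r)
    reassignments : Vector ℕ l × Vector ℕ r

  reassignedL : Vector ℕ l
  reassignedL = proj₁ reassignments

  reassignedR : Vector ℕ r
  reassignedR = proj₂ reassignments

open State

initial : ∀ {l r} → State l r
initial = state [] ((λ _ → 0) , (λ _ → 0))

FreeL : ∀ {l r} → List (Edge l r) → Fin l → Set
FreeL M i = i ∉ map proj₁ M

freeL? : ∀ {l r} (M : List (Edge l r)) (i : Fin l) → Dec (FreeL M i)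
freeL? M i = ¬? (i ∈? map proj₁ M)
  where open DecMembership Fin._≟_ using (_∈?_)

module _ {l r : ℕ} (G : BipartiteGraph l r) where

  IsAugmenting : List (Edge l r) → Fin r → Path l r → Set
  IsAugmenting M j (direct i)   = E G i j × FreeL M i
  IsAugmenting M j (swap x y i) = E G x j × (x , y) ∈ M × E G i y × FreeL M i

  isAugmenting? : ∀ M j p → Dec (IsAugmenting M j p)
  isAugmenting? M j (direct i)   = E? G i j ×-dec freeL? M i
  isAugmenting? M j (swap x y i) =
    E? G x j ×-dec (x , y) ∈? M ×-dec E? G i y ×-dec freeL? M i
    where open DecMembership _≟ᵉ_ using (_∈?_)

WithinBudget : ∀ {l r} → Budget → Budget → State l r → Path l r → Set
WithinBudget s t σ (direct i)   = ⊤
WithinBudget s t σ (swap x y i) =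
  [ reassignedL σ x ] <⁺ s × [ reassignedR σ y ] <⁺ t

withinBudget? : ∀ {l r} s t (σ : State l r) p → Dec (WithinBudget s t σ p)
withinBudget? s t σ (direct i)   = yes tt
withinBudget? s t σ (swap x y i) =
  <⁺-dec _<?_ [ reassignedL σ x ] s ×-dec <⁺-dec _<?_ [ reassignedR σ y ] t

augment : ∀ {l r} → Fin r → Path l r → State l r → State l r
augment j (direct i)   (state M c)         = state ((i , j) ∷ M) c
augment j (swap x y i) (state M (cL , cR)) =
  state ((x , j) ∷ (i , y) ∷ filter (λ e → ¬? (e ≟ᵉ (x , y))) M)
        (updateAt cL x suc , updateAt cR y suc)

cost : ∀ {l r} → State l r → Path l r → ℤ
cost σ (direct i)   = -1ℤ
cost σ (swap x y i) = + reassignedR σ y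

-- The online vertices that have arrived, latest first, with their
-- neighbourhoods.
Revealed : ℕ → ℕ → Set
Revealed l r = List (Fin r × Subset l)

-- A rule sees what has been revealed, including the vertex that has just
-- arrived, and the current state; it picks one of the minimum-cost paths.
TieBreaking : Set
TieBreaking = ∀ {l r} → Revealed l r → State l r →
              (ps : List⁺ (Path l r)) → ∃[ p ] p ∈ toList ps

module LCP (s t : Budget) (rule : TieBreaking)
           {l r : ℕ} (G : BipartiteGraph l r) where

  Feasible : State l r → Fin r → Path l r → Set
  Feasible σ j p = IsAugmenting G (M σ) j p × WithinBudget s t σ p

  feasiblePaths : State l r → Fin r → List (Path l r)
  feasiblePaths σ j =
    filter (λ p → isAugmenting? G (M σ) j p ×-dec withinBudget? s t σ p) (paths l r)

  cheapestPaths : State l r → Fin r → List (Path l r)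
  cheapestPaths σ j = filter (λ p → all? (λ q → cost σ p ℤ.≤? cost σ q) ps) ps
    where ps = feasiblePaths σ j

  -- Some feasible path has least cost, so cheapestPaths is empty exactly when
  -- feasiblePaths is.
  step : Revealed l r → State l r → Fin r → State l r
  step h σ j with cheapestPaths σ j
  ... | []     = σ
  ... | p ∷ ps = augment j (proj₁ (rule h σ (p ∷ ps))) σ

  process : Revealed l r → State l r → List (Fin r) → State l r
  process h σ []       = σ
  process h σ (j ∷ js) = process h′ (step h′ σ j) js
    where h′ = (j , neighbours G j) ∷ h

  -- π sends each arrival time to the vertex arriving then.
  finalMatching : Permutation′ r → List (Edge l r)
  finalMatching π = M (process [] initial (tabulate (π ⟨$⟩ʳ_)))

∈-listsUpTo : ∀ {a} {A : Set a} {xs : List A} → (∀ x → x ∈ xs) →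
              ∀ n ys → length ys ≤ n → ys ∈ listsUpTo n xs
∈-listsUpTo all∈ zero    []       _         = here refl
∈-listsUpTo all∈ (suc n) []       _         = here refl
∈-listsUpTo all∈ (suc n) (y ∷ ys) (s≤s ys≤n) =
  there (∈-cartesianProductWith⁺ _∷_ (all∈ y) (∈-listsUpTo all∈ n ys ys≤n))

lookup-injective : ∀ {a} {A : Set a} {xs : List A} → Unique xs →
                   ∀ i j → lookup xs i ≡ lookup xs j → i ≡ j
lookup-injective (x∉ ∷ u) zero    zero    eq = refl
lookup-injective (x∉ ∷ u) zero    (suc j) eq = contradiction eq (All.lookup x∉ (∈-lookup j))
lookup-injective (x∉ ∷ u) (suc i) zero    eq = contradiction (sym eq) (All.lookup x∉ (∈-lookup i))
lookup-injective (x∉ ∷ u) (suc i) (suc j) eq = cong suc (lookup-injective u i j eq)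

length-matching : ∀ {l r} (G : BipartiteGraph l r) {N} → IsMatching G N → length N ≤ l
length-matching G {N} (_ , disjoint) =
  subst (_≤ _) (length-map proj₁ N)
    (Fin.injective⇒≤ {f = lookup (map proj₁ N)}
      (lookup-injective (AllPairs.map⁺ (AllPairs.map proj₁ disjoint)) _ _))

ν-maximum : ∀ {l r} (G : BipartiteGraph l r) →
            (∃[ N ] IsMatching G N × length N ≡ ν G) ×
            (∀ N → IsMatching G N → length N ≤ ν G)
ν-maximum {l} {r} G = attained , bound
  where
  lengths = map length (matchings G)

  attained : ∃[ N ] IsMatching G N × length N ≡ ν G
  attained with argmax-sel (λ n → n) 0 lengths
  ... | inj₁ ν≡0 = [] , ([] , []) , sym ν≡0
  ... | inj₂ ν∈  with ∈-map⁻ length ν∈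
  ...   | N , N∈ , ν≡ = N , proj₂ (∈-filter⁻ (isMatching? G) {xs = listsUpTo l _} N∈) , sym ν≡

  bound : ∀ N → IsMatching G N → length N ≤ ν G
  bound N N-matching = All.lookup (xs≤max 0 lengths)
    (∈-map⁺ length (∈-filter⁺ (isMatching? G)
      (∈-listsUpTo (λ (i , j) → ∈-cartesianProduct⁺ (∈-allFin i) (∈-allFin j))
                   l N (length-matching G N-matching))
      N-matching))

{-# OPTIONS --safe #-}
-- The final matching M admits no augmenting path of length 1 or 3.  An arriving
-- vertex swaps only if it has no free neighbour, so the partner of an exhausted
-- vertex never has a free neighbour again, and an exhausted vertex never blocks
-- an augmenting path.
--
-- Let N be a matching.  Every edge of N has an endpoint matched by M.  Sending
-- an edge of N to the edge of M at its offline endpoint is injective, and so is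
-- the same with online endpoints.  On the edges of N with exactly one matched
-- endpoint, taking the edge of M there is also injective, for a collision would
-- be an augmenting path of length 3.  Every edge of N is in the domain of two
-- of these three maps, so 2 |N| ≤ 3 |M|.
module Submission where

open import Data.Fin using (Fin; zero; suc)
import Data.Fin.Properties as Fin
open import Data.Fin.Permutation using (Permutation′; _⟨$⟩ʳ_; _⟨$⟩ˡ_; inverseʳ)
import Data.Integer as ℤ
import Data.Integer.Properties as ℤ
open import Data.List using (List; []; _∷_; map; filter; length; lookup; tabulate)
import Data.List.Extrema ℤ.≤-totalOrder as Extrema
import Data.List.Membership.DecPropositional as DecMembership
open import Data.List.Membership.Propositional using (_∈_; _∉_)
open import Data.List.Membership.Propositional.Properties using
  (∈-map⁺; ∈-map⁻; ∈-filter⁺; ∈-filter⁻; ∈-++⁺ˡ; ∈-++⁺ʳ; ∈-cartesianProduct⁺; ∈-allFin; ∈-lookup; ∈-tabulate⁺)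
open import Data.List.NonEmpty using (_∷_)
open import Data.List.Relation.Unary.All as All using (All; []; _∷_; all?)
import Data.List.Relation.Unary.All.Properties as All
open import Data.List.Relation.Unary.AllPairs as AllPairs using (AllPairs; _∷_)
import Data.List.Relation.Unary.AllPairs.Properties as AllPairs
open import Data.List.Relation.Unary.Any as Any using (Any; here; there; index)
import Data.List.Relation.Unary.Any.Properties as Any
open import Data.Nat using (ℕ; zero; suc; _+_; _*_; _≤_; z≤n; s≤s; z<s)
open import Data.Nat.Properties using (≤-trans; n≤1+n; +-mono-≤; +-identityʳ; +-monoʳ-≤; *-suc; module ≤-Reasoning)
open import Data.Nat.Tactic.RingSolver using (solve-∀)
open import Data.Product using (∃-syntax; _×_; _,_; proj₁; proj₂; uncurry)
open import Data.Sum using (_⊎_; inj₁; inj₂; [_,_]′)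
open import Data.Vec.Functional.Properties using (updateAt-minimal)
open import Function using (_∘_)
open import Relation.Binary using (REL)
open import Relation.Binary.PropositionalEquality using (_≡_; _≢_; refl; sym; trans; cong; subst)
open import Relation.Nullary using (yes; no; ¬_; ¬?; _×-dec_; contradiction)
open import Relation.Nullary.Construct.Add.Supremum using (⊤⁺; [_])
open import Relation.Binary.Construct.Add.Supremum.Strict Data.Nat._<_ using (_<⁺_; [_]; [_]<⊤⁺)
open import Relation.Unary using (Pred; Decidable)
open import Defs

-- Counting in lists: injections and double counting.

module _ {a b ℓ} {A : Set a} {B : Set b} {R : REL A B ℓ} {ys : List B} where

  private
    position : ∀ {xs} → All (λ x → Any (R x) ys) xs → Fin (length xs) → Fin (length ys)
    position (p ∷ ps) zero    = index p
    position (p ∷ ps) (suc k) = position ps k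

    position-related : ∀ {xs} (ps : All (λ x → Any (R x) ys) xs) k →
                       R (lookup xs k) (lookup ys (position ps k))
    position-related (p ∷ ps) zero    = Any.lookup-index p
    position-related (p ∷ ps) (suc k) = position-related ps k

    position-injective : ∀ {xs} → AllPairs (λ x x′ → ∀ y → y ∈ ys → R x y → ¬ R x′ y) xs →
                         (ps : All (λ x → Any (R x) ys) xs) →
                         ∀ {k k′} → position ps k ≡ position ps k′ → k ≡ k′
    position-injective (_ ∷ _) (_ ∷ _) {zero} {zero} _ = refl
    position-injective (d ∷ _) (p ∷ ps) {zero} {suc k} eq =
      contradiction (subst (R _ ∘ lookup ys) (sym eq) (position-related ps k))
                    (All.lookup d (∈-lookup k) _ (∈-lookup (index p)) (Any.lookup-index p))
    position-injective (d ∷ _) (p ∷ ps) {suc k} {zero} eq =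
      contradiction (subst (R _ ∘ lookup ys) eq (position-related ps k))
                    (All.lookup d (∈-lookup k) _ (∈-lookup (index p)) (Any.lookup-index p))
    position-injective (_ ∷ ds) (_ ∷ ps) {suc _} {suc _} eq =
      cong suc (position-injective ds ps eq)

  -- Each entry of `xs` picks the position of one related entry of `ys`. The first hypothesis says
  -- that no entry of `ys` is related to two entries of `xs`, so the picked positions are distinct.
  length-≤-related : ∀ {xs} → AllPairs (λ x x′ → ∀ y → y ∈ ys → R x y → ¬ R x′ y) xs →
                     All (λ x → Any (R x) ys) xs → length xs ≤ length ys
  length-≤-related ds ps = Fin.injective⇒≤ (position-injective ds ps)

module _ {a p q r} {A : Set a} {P : Pred A p} {Q : Pred A q} {R : Pred A r}
         (P? : Decidable P) (Q? : Decidable Q) (R? : Decidable R) where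

  private
    #P = length ∘ filter P?
    #Q = length ∘ filter Q?
    #R = length ∘ filter R?

    bound : ∀ {s t} n → t ≡ 2 + s → 2 * n ≤ s → 2 * suc n ≤ t
    bound n refl 2n≤s rewrite *-suc 2 n = s≤s (s≤s 2n≤s)

    suc₁₂ : ∀ a b c → suc a + (suc b + c) ≡ 2 + (a + (b + c))
    suc₁₂ = solve-∀

    suc₁₃ : ∀ a b c → suc a + (b + suc c) ≡ 2 + (a + (b + c))
    suc₁₃ = solve-∀

    suc₂₃ : ∀ a b c → a + (suc b + suc c) ≡ 2 + (a + (b + c))
    suc₂₃ = solve-∀

  -- Each entry adds at least two to the sum of the three counts; `suc₁₂`, `suc₁₃` and `suc₂₃` serve
  -- the three choices of two counts that grow.
  length-filter-twice : ∀ {xs} → All (λ x → P x × Q x ⊎ P x × R x ⊎ Q x × R x) xs →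
    2 * length xs ≤ #P xs + (#Q xs + #R xs)
  length-filter-twice [] = z≤n
  length-filter-twice {x ∷ xs} (two ∷ twos)
    with P? x | Q? x | R? x | two | length-filter-twice twos
  -- The sum grows by three here: `bound` accounts for two, and monotonicity absorbs the third.
  ... | yes _ | yes _ | yes _ | _ | ih = ≤-trans
    (bound (length xs) (suc₁₂ (#P xs) (#Q xs) (#R xs)) ih)
    (+-monoʳ-≤ (suc (#P xs)) (+-monoʳ-≤ (suc (#Q xs)) (n≤1+n (#R xs))))
  ... | yes _ | yes _ | no _  | _ | ih = bound (length xs) (suc₁₂ (#P xs) (#Q xs) (#R xs)) ih
  ... | yes _ | no _  | yes _ | _ | ih = bound (length xs) (suc₁₃ (#P xs) (#Q xs) (#R xs)) ih
  ... | no _  | yes _ | yes _ | _ | ih = bound (length xs) (suc₂₃ (#P xs) (#Q xs) (#R xs)) ih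
  ... | yes _ | no ¬q | no ¬r | t | _  = contradiction t [ ¬q ∘ proj₂ , [ ¬r ∘ proj₂ , ¬r ∘ proj₂ ]′ ]′
  ... | no ¬p | yes _ | no ¬r | t | _  = contradiction t [ ¬p ∘ proj₁ , [ ¬p ∘ proj₁ , ¬r ∘ proj₂ ]′ ]′
  ... | no ¬p | no ¬q | _     | t | _  = contradiction t [ ¬p ∘ proj₁ , [ ¬p ∘ proj₁ , ¬q ∘ proj₁ ]′ ]′

-- Matchings without short augmenting paths.

module _ {l r : ℕ} (G : BipartiteGraph l r) where
  open BipartiteGraph G using (E)
  open DecMembership (Fin._≟_ {l}) using () renaming (_∈?_ to _∈ˡ?_)
  open DecMembership (Fin._≟_ {r}) using () renaming (_∈?_ to _∈ʳ?_)

  -- Phrased with `IsAugmenting`, hence blind to budgets. For a matching held by LCP this is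
  -- stronger than the absence of a feasible path.
  NoAugmentingPath : List (Edge l r) → Fin r → Set
  NoAugmentingPath M j = j ∉ map proj₂ M → ∀ p → ¬ IsAugmenting G M j p

  no-augmenting-path⇒⅔ : ∀ {M N} → (∀ j → NoAugmentingPath M j) → IsMatching G N →
                         2 * length N ≤ 3 * length M
  no-augmenting-path⇒⅔ {M} {N} stuck (edges , disjoint) = begin
    2 * length N
      ≤⟨ length-filter-twice matchedL? matchedR? single? (All.map twice edges) ⟩
    length (filter matchedL? N) + (length (filter matchedR? N) + length (filter single? N))
      ≤⟨ +-mono-≤ left (+-mono-≤ right one-sided) ⟩
    length M + (length M + length M)
      ≡⟨ cong (λ n → length M + (length M + n)) (sym (+-identityʳ _)) ⟩
    3 * length M ∎
    where
    open ≤-Reasoning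

    MatchedL MatchedR Single : Pred (Edge l r) _
    MatchedL e = proj₁ e ∈ map proj₁ M
    MatchedR e = proj₂ e ∈ map proj₂ M
    Single e   = ¬ (MatchedL e × MatchedR e)

    matchedL? : Decidable MatchedL
    matchedL? e = proj₁ e ∈ˡ? map proj₁ M

    matchedR? : Decidable MatchedR
    matchedR? e = proj₂ e ∈ʳ? map proj₂ M

    single? : Decidable Single
    single? e = ¬? (matchedL? e ×-dec matchedR? e)

    twice : ∀ {e} → uncurry E e →
            MatchedL e × MatchedR e ⊎ MatchedL e × Single e ⊎ MatchedR e × Single e
    twice {e} ij with matchedL? e | matchedR? e
    ... | yes iM | yes jM = inj₁ (iM , jM)
    ... | yes iM | no ¬jM = inj₂ (inj₁ (iM , ¬jM ∘ proj₂))
    ... | no ¬iM | yes jM = inj₂ (inj₂ (jM , ¬iM ∘ proj₁))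
    -- With both ends unmatched, the edge would itself be an augmenting path of length 1.
    ... | no ¬iM | no ¬jM = contradiction (ij , ¬iM) (stuck _ ¬jM (direct _))

    left : length (filter matchedL? N) ≤ length M
    left = length-≤-related {R = λ e m → proj₁ e ≡ proj₁ m}
      (AllPairs.map (λ (i≢i′ , _) _ _ eq eq′ → i≢i′ (trans eq (sym eq′)))
        (AllPairs.filter⁺ matchedL? disjoint))
      (All.map Any.map⁻ (All.all-filter matchedL? N))

    right : length (filter matchedR? N) ≤ length M
    right = length-≤-related {R = λ e m → proj₂ e ≡ proj₂ m}
      (AllPairs.map (λ (_ , j≢j′) _ _ eq eq′ → j≢j′ (trans eq (sym eq′)))
        (AllPairs.filter⁺ matchedR? disjoint))
      (All.map Any.map⁻ (All.all-filter matchedR? N))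

    -- Being a single edge of the graph is part of the relation, since the disjointness condition of
    -- `length-≤-related` passes on only facts carried by the relation, and `collision` needs these.
    Meets : REL (Edge l r) (Edge l r) _
    Meets e m = (uncurry E e × Single e) × (proj₁ e ≡ proj₁ m ⊎ proj₂ e ≡ proj₂ m)

    -- Singleness leaves `j` unmatched, as `x` is matched, and `i` free, as `y` is matched. So
    -- `[ j x y i ]` would be an augmenting path.
    collision : ∀ {x j i y} → (x , y) ∈ M → uncurry E (x , j) × Single (x , j) →
                ¬ (uncurry E (i , y) × Single (i , y))
    collision xy (xj , single) (iy , single′) =
      stuck _ (λ jM → single (∈-map⁺ proj₁ xy , jM)) (swap _ _ _)
        (xj , xy , iy , λ iM → single′ (iM , ∈-map⁺ proj₂ xy))

    disjoint⇒¬meets : ∀ {e e′} → VertexDisjoint e e′ → ∀ m → m ∈ M → Meets e m → ¬ Meets e′ m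
    disjoint⇒¬meets (i≢i′ , _) _ _ (_ , inj₁ refl) (_ , inj₁ refl) = i≢i′ refl
    disjoint⇒¬meets (_ , j≢j′) _ _ (_ , inj₂ refl) (_ , inj₂ refl) = j≢j′ refl
    disjoint⇒¬meets _ _ m∈ (s , inj₁ refl) (s′ , inj₂ refl) = collision m∈ s s′
    disjoint⇒¬meets _ _ m∈ (s , inj₂ refl) (s′ , inj₁ refl) = collision m∈ s′ s

    meets : ∀ {e} → uncurry E e × Single e → Any (Meets e) M
    meets {e} (ij , single) with twice ij
    ... | inj₁ both            = contradiction both single
    ... | inj₂ (inj₁ (iM , _)) = Any.map (λ eq → (ij , single) , inj₁ eq) (Any.map⁻ iM)
    ... | inj₂ (inj₂ (jM , _)) = Any.map (λ eq → (ij , single) , inj₂ eq) (Any.map⁻ jM)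

    one-sided : length (filter single? N) ≤ length M
    one-sided = length-≤-related
      (AllPairs.map disjoint⇒¬meets (AllPairs.filter⁺ single? disjoint))
      (All.map meets (All.zip (All.filter⁺ single? edges , All.all-filter single? N)))

-- Paths, and what an augmentation keeps matched.

∈-paths : ∀ {l r} (p : Path l r) → p ∈ paths l r
∈-paths (direct i)   = ∈-++⁺ˡ (∈-map⁺ direct (∈-allFin i))
∈-paths (swap x y i) = ∈-++⁺ʳ _ (∈-map⁺ _
  (∈-cartesianProduct⁺ (∈-allFin x) (∈-cartesianProduct⁺ (∈-allFin y) (∈-allFin i))))

module _ {l r : ℕ} (j : Fin r) where
  open State

  -- A swap covers both ends of the removed edge again: `x` by its edge to `j`, and `y` by its edge
  -- to the formerly free vertex. Matched vertices thus stay matched on both sides.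
  augment-coversˡ : ∀ p (σ : State l r) {i} →
                    i ∈ map proj₁ (M σ) → i ∈ map proj₁ (M (augment j p σ))
  augment-coversˡ (direct _)   σ i∈ = there i∈
  augment-coversˡ (swap x y _) σ i∈ with ∈-map⁻ proj₁ i∈
  ... | e , e∈ , refl with e ≟ᵉ (x , y)
  ...   | yes refl = here refl
  ...   | no e≢    = there (there (∈-map⁺ proj₁ (∈-filter⁺ _ e∈ e≢)))

  augment-coversʳ : ∀ p (σ : State l r) {k} →
                    k ∈ map proj₂ (M σ) → k ∈ map proj₂ (M (augment j p σ))
  augment-coversʳ (direct _)   σ k∈ = there k∈
  augment-coversʳ (swap x y _) σ k∈ with ∈-map⁻ proj₂ k∈
  ... | e , e∈ , refl with e ≟ᵉ (x , y)
  ...   | yes refl = there (here refl)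
  ...   | no e≢    = there (there (∈-map⁺ proj₂ (∈-filter⁺ _ e∈ e≢)))

  augment-matches : ∀ p (σ : State l r) → j ∈ map proj₂ (M (augment j p σ))
  augment-matches (direct _)   σ = here refl
  augment-matches (swap _ _ _) σ = here refl

-- The move chosen by LCP.

module _ (rule : TieBreaking) {l r : ℕ} (G : BipartiteGraph l r) where
  open BipartiteGraph G using (E)
  open State

  open LCP [ 1 ] ⊤⁺ rule G

  IsCheapest : State l r → Fin r → Path l r → Set
  IsCheapest σ j p = Feasible σ j p × (∀ q → Feasible σ j q → cost σ p ℤ.≤ cost σ q)

  module _ (σ : State l r) (j : Fin r) where

    private
      feasible? : Decidable (Feasible σ j)
      feasible? p = isAugmenting? G (M σ) j p ×-dec withinBudget? [ 1 ] ⊤⁺ σ p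

      Least : Pred (Path l r) _
      Least p = All (λ q → cost σ p ℤ.≤ cost σ q) (feasiblePaths σ j)

      least? : Decidable Least
      least? p = all? (λ q → cost σ p ℤ.≤? cost σ q) (feasiblePaths σ j)

    ∈-feasiblePaths⁺ : ∀ {p} → Feasible σ j p → p ∈ feasiblePaths σ j
    ∈-feasiblePaths⁺ = ∈-filter⁺ feasible? (∈-paths _)

    ∈-cheapestPaths⁻ : ∀ {p} → p ∈ cheapestPaths σ j → IsCheapest σ j p
    ∈-cheapestPaths⁻ p∈ with ∈-filter⁻ least? {xs = feasiblePaths σ j} p∈
    ... | p∈′ , least = proj₂ (∈-filter⁻ feasible? {xs = paths l r} p∈′)
                      , λ q feasible → All.lookup least (∈-feasiblePaths⁺ feasible)

    cheapestPaths-nonempty : ∀ {p} → Feasible σ j p → ∃[ q ] q ∈ cheapestPaths σ j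
    cheapestPaths-nonempty {p} feasible =
      q , ∈-filter⁺ least? q∈ (Extrema.f[argmin]≤f[xs] {f = cost σ} p (feasiblePaths σ j))
      where
      -- The default value of `argmin` is the given path `p`. It is feasible, so the minimiser lies
      -- in the list even when it is the default.
      q = Extrema.argmin (cost σ) p (feasiblePaths σ j)

      q∈ : q ∈ feasiblePaths σ j
      q∈ with Extrema.argmin-sel (cost σ) p (feasiblePaths σ j)
      ... | inj₁ q≡p = subst (_∈ feasiblePaths σ j) (sym q≡p) (∈-feasiblePaths⁺ feasible)
      ... | inj₂ q∈ps = q∈ps

    step-cases : ∀ h → ((∀ p → ¬ Feasible σ j p) × step h σ j ≡ σ)
                     ⊎ (∃[ p ] IsCheapest σ j p × step h σ j ≡ augment j p σ)
    -- Both lemmas are abstracted together with the list, so that in each branch they speak of the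
    -- list just matched.
    step-cases h with cheapestPaths σ j | ∈-cheapestPaths⁻ | cheapestPaths-nonempty
    ... | []     | _        | nonempty = inj₁ ((λ _ f → contradiction (proj₂ (nonempty f)) λ ()) , refl)
    ... | p ∷ ps | cheapest | _        with rule h σ (p ∷ ps)
    ...   | q , q∈ = inj₂ (q , cheapest q∈ , refl)

  -- The invariant and its preservation by one arrival.

  record Invariant (waiting : List (Fin r)) (σ : State l r) : Set where
    field
      -- Ensures that removing `(x , y)` in a swap leaves no old edge at `x`.
      partner-unique    : ∀ {x y y′} → (x , y) ∈ M σ → (x , y′) ∈ M σ → y ≡ y′
      -- Makes `no-free-neighbour` vacuous at the new edge of a vertex that has just ceased to be
      -- free.
      free-unreassigned : ∀ {x} → FreeL (M σ) x → reassignedL σ x ≡ 0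
      -- With offline budget 1, a nonzero count means that `x` is exhausted. A swap blocked for this
      -- reason would have to end at a free neighbour of `y`.
      no-free-neighbour : ∀ {x y i} → reassignedL σ x ≢ 0 → (x , y) ∈ M σ → E i y → ¬ FreeL (M σ) i
      stuck             : ∀ {k} → k ∉ waiting → NoAugmentingPath G (M σ) k

  open Invariant

  module _ {σ : State l r} {j : Fin r} {js : List (Fin r)} (inv : Invariant (j ∷ js) σ) where

    private
      arrived : ∀ {k} → k ∉ js → k ≢ j → k ∉ j ∷ js
      arrived k∉ k≢j (here k≡j) = k≢j k≡j
      arrived k∉ k≢j (there k∈) = k∉ k∈

    -- Since the online budget is infinite, only an exhausted `x` can make an augmenting path
    -- infeasible, and `no-free-neighbour` excludes that case. So `j` has no augmenting path even
    -- when budgets are ignored.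
    infeasible-invariant : (∀ p → ¬ Feasible σ j p) → Invariant js σ
    infeasible-invariant infeasible = record
      { partner-unique    = partner-unique inv
      ; free-unreassigned = free-unreassigned inv
      ; no-free-neighbour = no-free-neighbour inv
      ; stuck             = stuck′
      }
      where
      none : ∀ p → ¬ IsAugmenting G (M σ) j p
      none (direct i) aug = infeasible (direct i) (aug , _)
      none (swap x y i) aug@(_ , xy , iy , free) with reassignedL σ x in eq
      ... | suc _ = no-free-neighbour inv (λ eq′ → contradiction (trans (sym eq) eq′) λ ()) xy iy free
      ... | zero  = infeasible (swap x y i)
        (aug , subst (λ n → [ n ] <⁺ [ 1 ]) (sym eq) [ z<s ] , [ _ ]<⊤⁺)

      stuck′ : ∀ {k} → k ∉ js → NoAugmentingPath G (M σ) k
      stuck′ {k} k∉ with k Fin.≟ j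
      ... | yes refl = λ _ → none
      ... | no k≢j   = stuck inv (arrived k∉ k≢j)

    private
      -- A vertex unmatched after the move is not `j`, which the move matches, and was unmatched
      -- before it. Hence `stuck` is maintained by turning each new augmenting path into an old one
      -- from the same vertex, or into a contradiction.
      stuck-before : ∀ p {k} → k ∉ js → k ∉ map proj₂ (M (augment j p σ)) →
                     ∀ q → ¬ IsAugmenting G (M σ) k q
      stuck-before p {k} k∉ unmatched =
        stuck inv (arrived k∉ λ { refl → unmatched (augment-matches j p σ) })
                  (unmatched ∘ augment-coversʳ j p σ)

      free-before : ∀ p {i} → FreeL (M (augment j p σ)) i → FreeL (M σ) i
      free-before p free = free ∘ augment-coversˡ j p σ

    direct-invariant : ∀ {i} → FreeL (M σ) i → Invariant js (augment j (direct i) σ)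
    direct-invariant {i} i-free = record
      { partner-unique    = unique
      ; free-unreassigned = free-unreassigned inv ∘ free-before (direct i)
      ; no-free-neighbour = no-free
      ; stuck             = stuck′
      }
      where
      M′ = M (augment j (direct i) σ)

      unique : ∀ {x y y′} → (x , y) ∈ M′ → (x , y′) ∈ M′ → y ≡ y′
      unique (here refl) (here refl) = refl
      unique (here refl) (there e′)  = contradiction (∈-map⁺ proj₁ e′) i-free
      unique (there e)   (here refl) = contradiction (∈-map⁺ proj₁ e) i-free
      unique (there e)   (there e′)  = partner-unique inv e e′

      no-free : ∀ {x y k} → reassignedL σ x ≢ 0 → (x , y) ∈ M′ → E k y → ¬ FreeL M′ k
      no-free exhausted (here refl) _  _    = exhausted (free-unreassigned inv i-free)
      no-free exhausted (there e)   ky free = no-free-neighbour inv exhausted e ky (free-before (direct i) free)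

      stuck′ : ∀ {k} → k ∉ js → NoAugmentingPath G M′ k
      stuck′ k∉ unmatched (direct i′) (ik , free) =
        stuck-before (direct i) k∉ unmatched (direct i′) (ik , free-before (direct i) free)
      -- A path through the new edge enters it at `i`, which was free before, so `k` already had a
      -- path of length 1.
      stuck′ k∉ unmatched (swap _ _ _) (ik , here refl , _ , _) =
        stuck-before (direct i) k∉ unmatched (direct i) (ik , i-free)
      stuck′ k∉ unmatched (swap x y i′) (xk , there e , iy , free) =
        stuck-before (direct i) k∉ unmatched (swap x y i′) (xk , e , iy , free-before (direct i) free)

    -- The swap exhausts `x` and makes `j` its partner. The last hypothesis, that `j` has no free
    -- neighbour, is then what `no-free-neighbour` demands at `(x , j)`.
    swap-invariant : ∀ {x y i} → (x , y) ∈ M σ → FreeL (M σ) i →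
                     (∀ {k} → E k j → ¬ FreeL (M σ) k) →
                     Invariant js (augment j (swap x y i) σ)
    swap-invariant {x} {y} {i} xy i-free j-saturated = record
      { partner-unique    = unique
      -- Only the count of `x` changes among offline vertices, and `x` stays matched.
      ; free-unreassigned = λ free → trans (unchanged (λ { refl → free (here refl) }))
                                           (free-unreassigned inv (before free))
      ; no-free-neighbour = no-free
      ; stuck             = stuck′
      }
      where
      σ′ = augment j (swap x y i) σ
      M′ = M σ′

      before : ∀ {k} → FreeL M′ k → FreeL (M σ) k
      before = free-before (swap x y i)

      unchanged : ∀ {x′} → x′ ≢ x → reassignedL σ′ x′ ≡ reassignedL σ x′
      unchanged x′≢x = updateAt-minimal _ x (reassignedL σ) x′≢x

      x≢i : x ≢ i
      x≢i refl = i-free (∈-map⁺ proj₁ xy)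

      kept : ∀ {e} → e ∈ filter (λ e → ¬? (e ≟ᵉ (x , y))) (M σ) → e ∈ M σ × e ≢ (x , y)
      kept = ∈-filter⁻ (λ e → ¬? (e ≟ᵉ (x , y))) {xs = M σ}

      kept-x : ∀ {y′} → (x , y′) ∉ filter (λ e → ¬? (e ≟ᵉ (x , y))) (M σ)
      kept-x e with kept e
      ... | e∈ , e≢ = e≢ (cong (x ,_) (partner-unique inv e∈ xy))

      kept-i : ∀ {y′} → (i , y′) ∉ filter (λ e → ¬? (e ≟ᵉ (x , y))) (M σ)
      kept-i e = i-free (∈-map⁺ proj₁ (proj₁ (kept e)))

      unique : ∀ {x y y′} → (x , y) ∈ M′ → (x , y′) ∈ M′ → y ≡ y′
      unique (here refl)         (here refl)          = refl
      unique (here refl)         (there (here refl))  = contradiction refl x≢i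
      unique (here refl)         (there (there e′))   = contradiction e′ kept-x
      unique (there (here refl)) (here refl)          = contradiction refl x≢i
      unique (there (here refl)) (there (here refl))  = refl
      unique (there (here refl)) (there (there e′))   = contradiction e′ kept-i
      unique (there (there e))   (here refl)          = contradiction e kept-x
      unique (there (there e))   (there (here refl))  = contradiction e kept-i
      unique (there (there e))   (there (there e′))   =
        partner-unique inv (proj₁ (kept e)) (proj₁ (kept e′))

      no-free : ∀ {x y k} → reassignedL σ′ x ≢ 0 → (x , y) ∈ M′ → E k y → ¬ FreeL M′ k
      no-free _ (here refl) kj free = j-saturated kj (before free)
      -- The vertex `i` was free, so its count was 0, and it still is because `i` differs from `x`.
      no-free exhausted (there (here refl)) _ _ =
        exhausted (trans (unchanged (x≢i ∘ sym)) (free-unreassigned inv i-free))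
      no-free exhausted (there (there e)) ky free =
        no-free-neighbour inv
          (exhausted ∘ trans (unchanged (λ { refl → kept-x e })))
          (proj₁ (kept e)) ky (before free)

      stuck′ : ∀ {k} → k ∉ js → NoAugmentingPath G M′ k
      stuck′ k∉ unmatched (direct i′) (ik , free) =
        stuck-before (swap x y i) k∉ unmatched (direct i′) (ik , before free)
      -- A path through `(x , j)` would end at a free neighbour of `j`.
      stuck′ k∉ unmatched (swap _ _ _) (_ , here refl , ij , free) = j-saturated ij (before free)
      -- A path through `(i , y)` enters it at `i`, free before the swap.
      stuck′ k∉ unmatched (swap _ _ _) (ik , there (here refl) , _ , _) =
        stuck-before (swap x y i) k∉ unmatched (direct i) (ik , i-free)
      stuck′ k∉ unmatched (swap x′ y′ i′) (xk , there (there e) , iy , free) =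
        stuck-before (swap x y i) k∉ unmatched (swap x′ y′ i′) (xk , proj₁ (kept e) , iy , before free)

    augment-invariant : ∀ p → IsCheapest σ j p → Invariant js (augment j p σ)
    augment-invariant (direct i) (((_ , free) , _) , _) = direct-invariant free
    augment-invariant (swap x y i) (((_ , xy , _ , free) , _) , cheapest) =
      -- A free neighbour of `j` would give a feasible direct path of cost -1, below the nonnegative
      -- cost of the chosen swap.
      swap-invariant xy free λ kj k-free →
        contradiction (cheapest (direct _) ((kj , k-free) , _)) λ ()

    step-invariant : ∀ h → Invariant js (step h σ j)
    step-invariant h with step-cases σ j h
    ... | inj₁ (infeasible , eq)    = subst (Invariant js) (sym eq) (infeasible-invariant infeasible)
    ... | inj₂ (p , cheapest , eq) = subst (Invariant js) (sym eq) (augment-invariant p cheapest)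

  -- The whole run and the ratio.

  process-invariant : ∀ h σ js → Invariant js σ → Invariant [] (process h σ js)
  process-invariant h σ []       inv = inv
  process-invariant h σ (j ∷ js) inv = process-invariant _ _ js (step-invariant inv _)

  initial-invariant : ∀ {js} → (∀ k → k ∈ js) → Invariant js initial
  initial-invariant all∈ = record
    { partner-unique    = λ ()
    ; free-unreassigned = λ _ → refl
    ; no-free-neighbour = λ exhausted → contradiction refl exhausted
    ; stuck             = λ k∉ → contradiction (all∈ _) k∉
    }

  finalMatching-stuck : ∀ π j → NoAugmentingPath G (finalMatching π) j
  finalMatching-stuck π j = stuck
    (process-invariant [] initial (tabulate (π ⟨$⟩ʳ_)) (initial-invariant λ k →
      -- Each online vertex `k` arrives, namely at time `π ⟨$⟩ˡ k`, so all are waiting at the start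
      -- and none at the end.
      subst (_∈ tabulate (π ⟨$⟩ʳ_)) (inverseʳ π) (∈-tabulate⁺ (π ⟨$⟩ˡ k))))
    λ ()

theorem13 : (rule : TieBreaking) (l r : ℕ) (G : BipartiteGraph l r) (π : Permutation′ r) →
    2 * ν G ≤ 3 * length (LCP.finalMatching [ 1 ] ⊤⁺ rule G π)
theorem13 rule l r G π with proj₁ (ν-maximum G)
... | N , matching , N≡ν =
  subst (λ n → 2 * n ≤ 3 * length (LCP.finalMatching [ 1 ] ⊤⁺ rule G π)) N≡ν
    (no-augmenting-path⇒⅔ G (finalMatching-stuck rule G π) matching)
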